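{- Let $A$ be a commutative ring, $X_\bullet$ any simplicial $A$-module, $p\ge1$ and $j\in\{0,\dots,p\}$. Then the Moore filler map $\mu_j$ is a section of the horn map $\Phi_j$ (that is, $\Phi_j\circ\mu_j=\operatorname{id}_{\operatorname{Horns}(p,j)}$), and $$X_p=R_{p,j}(X)\oplus D_p(X).$$ In particular, $\operatorname{im}(\mu_j)=D_p(X)$.
   Context: Let $F_j=\{0,\dots,p\}\setminus\{j\}$. For a simplicial $A$-module $X_\bullet$ with faces $d_i$ and degeneracies $s_i$: - $R_{p,j}(X)=\bigcap_{i\in F_j}\ker(d_i:X_p\to X_{p-1})$ is the horn kernel, and $D_p(X)=\sum_{r=0}^{p-1}\operatorname{im}(s_r:X_{p-1}\to X_p)$ is the degenerate submodule. - $\operatorname{Horns}(p,j)$ is the submodule of $\prod_{i\in F_j}X_{p-1}$ of tuples $(x_i)_{i\in F_j}$ with $d_ix_\ell=d_{\ell-1}x_i$ for all $i<\ell$ with $i,\ell\in F_j$. - The horn map $\Phi_j:X_p\to\operatorname{Horns}(p,j)$ is $\Phi_j(T)=(d_iT)_{i\in F_j}$. - The Moore filler map $\mu_j:\operatorname{Horns}(p,j)\to D_p(X)\subseteq X_p$ is defined on $H=(x_i)_{i\in F_j}$ as follows. Phase I: $T^{(-1)}:=0$ and, for $i=0,1,\dots,j-1$ in increasing order, $T^{(i)}:=T^{(i-1)}+s_i\bigl(x_i-d_iT^{(i-1)}\bigr)$. Phase II: $U^{(p+1)}:=T^{(j-1)}$ and, for $i=p,p-1,\dots,j+1$ in decreasing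 order, $U^{(i)}:=U^{(i+1)}+s_{i-1}\bigl(x_i-d_iU^{(i+1)}\bigr)$. Output: $\mu_j(H):=U^{(j+1)}$. -}

module Defs where

open import Algebra.Bundles using (CommutativeRing)
open import Algebra.Module.Bundles using (Module)
open import Algebra.Module.Morphism.Structures using (module ModuleMorphisms)
import Algebra.Properties.CommutativeMonoid.Sum as CommutativeMonoidSum
open import Data.Fin.Base using (Fin; zero; suc; inject₁; _≤_; _<_)
open import Data.Fin.Properties using (_<?_; <⇒≢)
open import Data.Nat.Base using (ℕ; zero; suc; _+_)
open import Data.Product.Base using (∃; ∃₂; _×_; _,_; proj₁; proj₂)
open import Data.Unit.Polymorphic.Base using (⊤; tt)
open import Data.Vec.Functional using (foldl; foldr)
open import Function.Base using (id; _∘_)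
open import Level using (Level; _⊔_) renaming (suc to lsuc)
open import Relation.Binary.Core using (Rel)
open import Relation.Binary.Definitions using (_Respects_)
open import Relation.Binary.PropositionalEquality.Core using (_≢_; ≢-sym)
open import Relation.Nullary.Decidable using (yes; no)
open import Relation.Unary using (Pred; _∈_)

module _ {r ℓr : Level} {A : CommutativeRing r ℓr} where

  private
    module A = CommutativeRing A

  ∣_∣ : ∀ {m ℓm} → Module A m ℓm → Set m
  ∣ M ∣ = Module.Carrierᴹ M

  IsLinear : ∀ {m₁ ℓm₁ m₂ ℓm₂} (M : Module A m₁ ℓm₁) (N : Module A m₂ ℓm₂) →
             (∣ M ∣ → ∣ N ∣) → Set (r ⊔ m₁ ⊔ ℓm₁ ⊔ ℓm₂)
  IsLinear M N = ModuleMorphisms.IsModuleHomomorphism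
                   (Module.rawModule M) (Module.rawModule N)

  -- The product module, with componentwise operations and equality.

  ∏ : ∀ {i m ℓm} (I : Set i) → (I → Module A m ℓm) → Module A (i ⊔ m) (i ⊔ ℓm)
  ∏ I M = record
    { Carrierᴹ = ∀ i → ∣ M i ∣
    ; _≈ᴹ_     = λ x y → ∀ i → M._≈ᴹ_ i (x i) (y i)
    ; _+ᴹ_     = λ x y i → M._+ᴹ_ i (x i) (y i)
    ; _*ₗ_     = λ a x i → M._*ₗ_ i a (x i)
    ; _*ᵣ_     = λ x a i → M._*ᵣ_ i (x i) a
    ; 0ᴹ       = λ i → M.0ᴹ i
    ; -ᴹ_      = λ x i → M.-ᴹ_ i (x i)
    ; isModule = record
      { isBimodule = record
        { isBisemimodule = record
          { +ᴹ-isCommutativeMonoid = record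
            { isMonoid = record
              { isSemigroup = record
                { isMagma = record
                  { isEquivalence = record
                    { refl  = λ i → M.≈ᴹ-refl i
                    ; sym   = λ p i → M.≈ᴹ-sym i (p i)
                    ; trans = λ p q i → M.≈ᴹ-trans i (p i) (q i)
                    }
                  ; ∙-cong = λ p q i → M.+ᴹ-cong i (p i) (q i)
                  }
                ; assoc = λ x y z i → M.+ᴹ-assoc i (x i) (y i) (z i)
                }
              ; identity = (λ x i → M.+ᴹ-identityˡ i (x i))
                         , (λ x i → M.+ᴹ-identityʳ i (x i))
              }
            ; comm = λ x y i → M.+ᴹ-comm i (x i) (y i)
            }
          ; isPreleftSemimodule = record
            { *ₗ-cong      = λ p q i → M.*ₗ-cong i p (q i)
            ; *ₗ-zeroˡ     = λ x i → M.*ₗ-zeroˡ i (x i)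
            ; *ₗ-distribʳ  = λ x a b i → M.*ₗ-distribʳ i (x i) a b
            ; *ₗ-identityˡ = λ x i → M.*ₗ-identityˡ i (x i)
            ; *ₗ-assoc     = λ a b x i → M.*ₗ-assoc i a b (x i)
            ; *ₗ-zeroʳ     = λ a i → M.*ₗ-zeroʳ i a
            ; *ₗ-distribˡ  = λ a x y i → M.*ₗ-distribˡ i a (x i) (y i)
            }
          ; isPrerightSemimodule = record
            { *ᵣ-cong      = λ p q i → M.*ᵣ-cong i (p i) q
            ; *ᵣ-zeroʳ     = λ x i → M.*ᵣ-zeroʳ i (x i)
            ; *ᵣ-distribˡ  = λ x a b i → M.*ᵣ-distribˡ i (x i) a b
            ; *ᵣ-identityʳ = λ x i → M.*ᵣ-identityʳ i (x i)
            ; *ᵣ-assoc     = λ x a b i → M.*ᵣ-assoc i (x i) a b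
            ; *ᵣ-zeroˡ     = λ a i → M.*ᵣ-zeroˡ i a
            ; *ᵣ-distribʳ  = λ a x y i → M.*ᵣ-distribʳ i a (x i) (y i)
            }
          ; *ₗ-*ᵣ-assoc = λ a x b i → M.*ₗ-*ᵣ-assoc i a (x i) b
          }
        ; -ᴹ‿cong    = λ p i → M.-ᴹ‿cong i (p i)
        ; -ᴹ‿inverse = (λ x i → M.-ᴹ‿inverseˡ i (x i))
                     , (λ x i → M.-ᴹ‿inverseʳ i (x i))
        }
      ; *ₗ-*ᵣ-coincident = λ a x i → M.*ₗ-*ᵣ-coincident i a (x i)
      }
    }
    where module M i = Module (M i)

  -- Closure under negation follows from closure under _*ₗ_.

  record Submodule {m ℓm} (M : Module A m ℓm) ℓ
                   : Set (r ⊔ m ⊔ ℓm ⊔ lsuc ℓ) where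
    open Module M
    field
      ⟨_⟩       : Pred Carrierᴹ ℓ
      resp      : ⟨_⟩ Respects _≈ᴹ_
      0-closed  : 0ᴹ ∈ ⟨_⟩
      +-closed  : ∀ {x y} → x ∈ ⟨_⟩ → y ∈ ⟨_⟩ → (x +ᴹ y) ∈ ⟨_⟩
      *ₗ-closed : ∀ a {x} → x ∈ ⟨_⟩ → (a *ₗ x) ∈ ⟨_⟩

  open Submodule public using (⟨_⟩)

  module _ {m ℓm m′ ℓm′} (M : Module A m ℓm) (N : Module A m′ ℓm′)
           {f : ∣ M ∣ → ∣ N ∣} (f-linear : IsLinear M N f) where
    private
      module M = Module M
      module N = Module N
      open ModuleMorphisms.IsModuleHomomorphism f-linear

    ker : Submodule M ℓm′
    ker = record
      { ⟨_⟩       = λ x → f x N.≈ᴹ N.0ᴹ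
      ; resp      = λ x≈y fx≈0 → N.≈ᴹ-trans (⟦⟧-cong (M.≈ᴹ-sym x≈y)) fx≈0
      ; 0-closed  = 0ᴹ-homo
      ; +-closed  = λ fx≈0 fy≈0 → N.≈ᴹ-trans (+ᴹ-homo _ _)
                      (N.≈ᴹ-trans (N.+ᴹ-cong fx≈0 fy≈0) (N.+ᴹ-identityˡ _))
      ; *ₗ-closed = λ a fx≈0 → N.≈ᴹ-trans (*ₗ-homo _ _)
                      (N.≈ᴹ-trans (N.*ₗ-cong A.refl fx≈0) (N.*ₗ-zeroʳ a))
      }

    im : Submodule N (m ⊔ ℓm′)
    im = record
      { ⟨_⟩       = λ y → ∃ λ x → f x N.≈ᴹ y
      ; resp      = λ y≈z (x , fx≈y) → x , N.≈ᴹ-trans fx≈y y≈z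
      ; 0-closed  = M.0ᴹ , 0ᴹ-homo
      ; +-closed  = λ (x , p) (y , q) →
                      x M.+ᴹ y , N.≈ᴹ-trans (+ᴹ-homo _ _) (N.+ᴹ-cong p q)
      ; *ₗ-closed = λ a (x , p) →
                      a M.*ₗ x , N.≈ᴹ-trans (*ₗ-homo _ _) (N.*ₗ-cong A.refl p)
      }

  module _ {m ℓm} {M : Module A m ℓm} where
    open Module M
    open CommutativeMonoidSum +ᴹ-commutativeMonoid
      using (sum; sum-cong-≋; ∑-distrib-+; sum-replicate-zero)

    ⋂ : ∀ {i ℓ} (I : Set i) → (I → Submodule M ℓ) → Submodule M (i ⊔ ℓ)
    ⋂ I P = record
      { ⟨_⟩       = λ x → ∀ i → x ∈ ⟨ P i ⟩
      ; resp      = λ x≈y p i → Submodule.resp (P i) x≈y (p i)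
      ; 0-closed  = λ i → Submodule.0-closed (P i)
      ; +-closed  = λ p q i → Submodule.+-closed (P i) (p i) (q i)
      ; *ₗ-closed = λ a p i → Submodule.*ₗ-closed (P i) a (p i)
      }

    *ₗ-distrib-sum : ∀ a {k} (y : Fin k → ∣ M ∣) →
                     a *ₗ sum y ≈ᴹ sum (λ i → a *ₗ y i)
    *ₗ-distrib-sum a {zero}  y = *ₗ-zeroʳ a
    *ₗ-distrib-sum a {suc k} y = ≈ᴹ-trans (*ₗ-distribˡ a _ _)
      (+ᴹ-cong ≈ᴹ-refl (*ₗ-distrib-sum a (y ∘ suc)))

    ∑ : ∀ {ℓ} (k : ℕ) → (Fin k → Submodule M ℓ) → Submodule M (m ⊔ ℓm ⊔ ℓ)
    ∑ k P = record
      { ⟨_⟩       = λ x → ∃ λ y → (∀ i → y i ∈ ⟨ P i ⟩) × x ≈ᴹ sum {k} y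
      ; resp      = λ x≈x′ (y , p , e) → y , p , ≈ᴹ-trans (≈ᴹ-sym x≈x′) e
      ; 0-closed  = (λ _ → 0ᴹ) , (λ i → Submodule.0-closed (P i))
                  , ≈ᴹ-sym (sum-replicate-zero k)
      ; +-closed  = λ (y , p , e) (y′ , p′ , e′) →
                      (λ i → y i +ᴹ y′ i)
                    , (λ i → Submodule.+-closed (P i) (p i) (p′ i))
                    , ≈ᴹ-trans (+ᴹ-cong e e′) (≈ᴹ-sym (∑-distrib-+ y y′))
      ; *ₗ-closed = λ a (y , p , e) →
                      (λ i → a *ₗ y i)
                    , (λ i → Submodule.*ₗ-closed (P i) a (p i))
                    , ≈ᴹ-trans (*ₗ-cong A.refl e) (*ₗ-distrib-sum a y)
      }

  -- M = P ⊕ Q as an internal direct sum: P + Q = M and P ∩ Q = 0.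

  record IsDirectSum {m ℓm ℓ₁ ℓ₂} (M : Module A m ℓm)
                     (P : Submodule M ℓ₁) (Q : Submodule M ℓ₂)
                     : Set (m ⊔ ℓm ⊔ ℓ₁ ⊔ ℓ₂) where
    open Module M
    field
      spanning : ∀ x → ∃₂ λ y z → y ∈ ⟨ P ⟩ × z ∈ ⟨ Q ⟩ × x ≈ᴹ y +ᴹ z
      disjoint : ∀ {x} → x ∈ ⟨ P ⟩ → x ∈ ⟨ Q ⟩ → x ≈ᴹ 0ᴹ

-- Each simplicial identity is indexed so that no subtraction of indices is
-- needed: a pair i < j is written (inject₁ i , suc j) with i ≤ j, and inject₁
-- changes only the type of an index, not its value.  The comments give the
-- identities in their usual form.

record SimplicialModule {r ℓr} (A : CommutativeRing r ℓr) m ℓm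
                        : Set (r ⊔ ℓr ⊔ lsuc (m ⊔ ℓm)) where
  field
    Ob       : ℕ → Module A m ℓm
    d        : ∀ {n} → Fin (2 + n) → ∣ Ob (suc n) ∣ → ∣ Ob n ∣
    s        : ∀ {n} → Fin (1 + n) → ∣ Ob n ∣ → ∣ Ob (suc n) ∣
    d-linear : ∀ {n} (i : Fin (2 + n)) → IsLinear (Ob (suc n)) (Ob n) (d i)
    s-linear : ∀ {n} (i : Fin (1 + n)) → IsLinear (Ob n) (Ob (suc n)) (s i)

  private
    Eq : ∀ n → Rel ∣ Ob n ∣ ℓm
    Eq n = Module._≈ᴹ_ (Ob n)

    syntax Eq n x y = x ≈[ n ] y

  field
    -- dᵢ dⱼ = dⱼ₋₁ dᵢ  for i < j
    d-d : ∀ {n} {i j : Fin (2 + n)} → i ≤ j → ∀ x →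
          d i (d (suc j) x) ≈[ n ] d j (d (inject₁ i) x)

    -- dᵢ sⱼ = sⱼ₋₁ dᵢ  for i < j
    d-s-< : ∀ {n} {i : Fin (2 + n)} {j : Fin (1 + n)} → i ≤ j → ∀ x →
            d (inject₁ i) (s (suc j) x) ≈[ suc n ] s j (d i x)

    -- dⱼ sⱼ = id
    d-s-≡ : ∀ {n} (j : Fin (1 + n)) x → d (inject₁ j) (s j x) ≈[ n ] x

    -- dⱼ₊₁ sⱼ = id
    d-s-suc : ∀ {n} (j : Fin (1 + n)) x → d (suc j) (s j x) ≈[ n ] x

    -- dᵢ sⱼ = sⱼ dᵢ₋₁  for i > j + 1
    d-s-> : ∀ {n} {i : Fin (2 + n)} {j : Fin (1 + n)} → j < i → ∀ x →
            d (suc i) (s (inject₁ j) x) ≈[ suc n ] s j (d i x)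

    -- sᵢ sⱼ = sⱼ₊₁ sᵢ  for i ≤ j
    s-s : ∀ {n} {i j : Fin (1 + n)} → i ≤ j → ∀ x →
          s (inject₁ i) (s j x) ≈[ 2 + n ] s (suc j) (s i x)

-- Proofs of i ≢ j are definitionally equal, so a function on F j is exactly
-- a tuple indexed by {0,…,p} ∖ {j}, where j : Fin (1 + p).

F : ∀ {k} → Fin k → Set
F j = ∃ λ i → i ≢ j

-- Throughout p = suc n, so that p ≥ 1 and X_{p-1} = Ob n.

module _ {r ℓr m ℓm} {A : CommutativeRing r ℓr}
         (X : SimplicialModule A m ℓm) where
  open SimplicialModule X

  module _ (n : ℕ) where

    R : Fin (2 + n) → Submodule (Ob (suc n)) ℓm
    R j = ⋂ (F j) λ (i , _) → ker (Ob (suc n)) (Ob n) (d-linear i)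

    D : Submodule (Ob (suc n)) (m ⊔ ℓm)
    D = ∑ (suc n) λ i → im (Ob n) (Ob (suc n)) (s-linear i)

    FaceTuples : Fin (2 + n) → Module A m ℓm
    FaceTuples j = ∏ (F j) λ _ → Ob n

  -- dᵢ x_ℓ = d_{ℓ-1} xᵢ for i < ℓ in F j, with the pair i < ℓ written
  -- (inject₁ i , suc l), i ≤ l.  For p = 1 there is no X_{p-2}, but F j is a
  -- singleton and the condition is vacuous.

  IsHorn : ∀ n (j : Fin (2 + n)) → Pred ∣ FaceTuples n j ∣ ℓm
  IsHorn zero    j x = ⊤
  IsHorn (suc n) j x = ∀ {i l : Fin (2 + n)} → i ≤ l →
    (i≢j : inject₁ i ≢ j) (l≢j : suc l ≢ j) →
    d i (x (suc l , l≢j)) ≈ᴹ d l (x (inject₁ i , i≢j))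
    where open Module (Ob n)

  Horns : ∀ n (j : Fin (2 + n)) → Submodule (FaceTuples n j) ℓm
  Horns zero j = record
    { ⟨_⟩       = IsHorn zero j
    ; resp      = λ _ _ → tt
    ; 0-closed  = tt
    ; +-closed  = λ _ _ → tt
    ; *ₗ-closed = λ _ _ → tt
    }
  Horns (suc n) j = record
    { ⟨_⟩       = IsHorn (suc n) j
    ; resp      = λ x≈y h {i} {l} i≤l i≢j l≢j →
        ≈ᴹ-trans (d.⟦⟧-cong i (≈-sym₁ (x≈y _)))
          (≈ᴹ-trans (h i≤l i≢j l≢j) (d.⟦⟧-cong l (x≈y _)))
    ; 0-closed  = λ {i} {l} _ _ _ →
        ≈ᴹ-trans (d.0ᴹ-homo i) (≈ᴹ-sym (d.0ᴹ-homo l))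
    ; +-closed  = λ h k {i} {l} i≤l i≢j l≢j →
        ≈ᴹ-trans (d.+ᴹ-homo i _ _)
          (≈ᴹ-trans (+ᴹ-cong (h i≤l i≢j l≢j) (k i≤l i≢j l≢j))
            (≈ᴹ-sym (d.+ᴹ-homo l _ _)))
    ; *ₗ-closed = λ a h {i} {l} i≤l i≢j l≢j →
        ≈ᴹ-trans (d.*ₗ-homo i _ _)
          (≈ᴹ-trans (*ₗ-cong (CommutativeRing.refl A) (h i≤l i≢j l≢j))
            (≈ᴹ-sym (d.*ₗ-homo l _ _)))
    }
    where
    open Module (Ob n)
    module d (i : Fin (2 + n)) =
      ModuleMorphisms.IsModuleHomomorphism (d-linear i)
    open Module (Ob (suc n)) using () renaming (≈ᴹ-sym to ≈-sym₁)

  module _ (n : ℕ) (j : Fin (2 + n)) where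

    private
      module Xₙ = Module (Ob n)
      module Xₚ = Module (Ob (suc n))

    Horn : Set (m ⊔ ℓm)
    Horn = ∃ λ x → x ∈ ⟨ Horns n j ⟩

    -- Equality in the submodule Horns: equality of the underlying tuples.

    _≈ᴴ_ : Rel Horn ℓm
    (x , _) ≈ᴴ (y , _) = Module._≈ᴹ_ (FaceTuples n j) x y

    -- Step i of phase I; indices i ≥ j are skipped.

    stepI : ∣ FaceTuples n j ∣ → ∣ Ob (suc n) ∣ → Fin (suc n) → ∣ Ob (suc n) ∣
    stepI x T i with inject₁ i <? j
    ... | yes i<j = T Xₚ.+ᴹ
          s i (x (inject₁ i , <⇒≢ i<j) Xₙ.+ᴹ (Xₙ.-ᴹ d (inject₁ i) T))
    ... | no  _   = T

    -- Step suc i of phase II; indices suc i ≤ j are skipped.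

    stepII : ∣ FaceTuples n j ∣ → Fin (suc n) → ∣ Ob (suc n) ∣ → ∣ Ob (suc n) ∣
    stepII x i U with j <? suc i
    ... | yes j<i = U Xₚ.+ᴹ
          s i (x (suc i , ≢-sym (<⇒≢ j<i)) Xₙ.+ᴹ (Xₙ.-ᴹ d (suc i) U))
    ... | no  _   = U

    -- On the vector id = (0 , … , n), foldl runs through the indices in
    -- increasing order and foldr in decreasing order.

    phaseI : ∣ FaceTuples n j ∣ → ∣ Ob (suc n) ∣
    phaseI x = foldl (stepI x) Xₚ.0ᴹ {suc n} id

    phaseII : ∣ FaceTuples n j ∣ → ∣ Ob (suc n) ∣ → ∣ Ob (suc n) ∣
    phaseII x T = foldr (stepII x) T {suc n} id

    μ : Horn → ∣ Ob (suc n) ∣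
    μ (x , _) = phaseII x (phaseI x)

    Im-μ : Pred ∣ Ob (suc n) ∣ (m ⊔ ℓm)
    Im-μ y = ∃ λ H → μ H Xₚ.≈ᴹ y

  Φ : ∀ n (j : Fin (2 + n)) → ∣ Ob (suc n) ∣ → Horn n j
  Φ zero    j T = (λ (i , _) → d i T) , tt
  Φ (suc n) j T = (λ (i , _) → d i T) , λ i≤l _ _ → d-d i≤l T

{-# OPTIONS --safe #-}

-- A filler step T ↦ T + sᵢ (x − d_c T), c ∈ {i , i + 1}, makes face c correct
-- and, by the horn condition, keeps the faces corrected before it; hence μ is
-- a section of Φ, and T = (T − μ (Φ T)) + μ (Φ T) shows that R + D is
-- everything.  For R ∩ D = 0, an element of R is fixed by each operator
-- 1 − sᵢ d_c with c ≠ j.  Such an operator kills im sᵢ, and it maps im s_r to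
-- itself if i < r, c = i or if i > r, c = i + 1.  Applied termwise to
-- x = ∑ y_r in the order of the Moore filler, these operators kill y₀ , … ,
-- y_{j-1} and then y_{p-1} , … , y_j.

module Submission where

open import Defs
open import Algebra.Bundles using (CommutativeMonoid; CommutativeRing)
open import Algebra.Module.Bundles using (Module)
import Algebra.Module.Properties as ModuleProperties
open import Algebra.Module.Morphism.Structures using (module ModuleMorphisms)
import Algebra.Properties.AbelianGroup as AbelianGroupProperties
import Algebra.Properties.CommutativeMonoid.Sum as CommutativeMonoidSum
import Algebra.Properties.CommutativeSemigroup as CommutativeSemigroupProperties
import Algebra.Properties.Group as GroupProperties
open import Data.Fin.Base using (Fin; zero; suc; inject₁; toℕ; fromℕ; _<_)
open import Data.Fin.Induction using (<-weakInduction; >-weakInduction)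
open import Data.Fin.Properties
  using (_<?_; <⇒≢; <-cmp; toℕ-injective; toℕ-inject₁; toℕ-fromℕ; toℕ<n)
open import Data.Nat.Base as ℕ using (ℕ; suc; _+_; z≤n; s≤s; s≤s⁻¹)
import Data.Nat.Properties as ℕ
open import Data.Product.Base using (∃; _×_; _,_; proj₁; proj₂)
open import Data.Sum.Base as Sum using (_⊎_; inj₁; inj₂)
open import Data.Vec.Functional using (foldl; foldr)
open import Function.Base using (id; _∘_)
open import Level using (Level; 0ℓ)
open import Relation.Binary.Definitions using (tri<; tri≈; tri>)
open import Relation.Binary.PropositionalEquality.Core
  using (_≡_; _≢_; refl; sym; subst; trans; ≢-sym)
import Relation.Binary.Reasoning.Setoid as SetoidReasoning
open import Relation.Nullary.Decidable using (yes; no)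
open import Relation.Nullary.Negation using (contradiction)
open import Relation.Unary using (Pred; _∈_; _≐_)

-- Fold invariants and index lowering.

module _ {a b p : Level} {A : Set a} {B : Set b} where

  foldl-invariant : ∀ (P : ℕ → Pred B p) (f : B → A → B) {z n} (xs : Fin n → A) →
    (∀ i {y} → P (toℕ i) y → P (suc (toℕ i)) (f y (xs i))) →
    P 0 z → P n (foldl f z xs)
  foldl-invariant P f {n = ℕ.zero} xs step z∈P = z∈P
  foldl-invariant P f {n = suc n}  xs step z∈P =
    foldl-invariant (P ∘ suc) f (xs ∘ suc) (step ∘ suc) (step zero z∈P)

  -- The index of `P` counts the leading entries not yet processed, so it descends from `n` to 0.
  foldr-invariant : ∀ (P : ℕ → Pred B p) (f : A → B → B) {z n} (xs : Fin n → A) →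
    (∀ i {y} → P (suc (toℕ i)) y → P (toℕ i) (f (xs i) y)) →
    P n z → P 0 (foldr f z xs)
  foldr-invariant P f {n = ℕ.zero} xs step z∈P = z∈P
  foldr-invariant P f {n = suc n}  xs step z∈P =
    step zero (foldr-invariant (P ∘ suc) f (xs ∘ suc) (step ∘ suc) z∈P)

-- An index below another is not the top one. This brings it into the `inject₁` form in which the
-- simplicial identities are stated.
<⇒inject₁ : ∀ {n} {i j : Fin (suc n)} → i < j → ∃ λ i′ → i ≡ inject₁ i′
<⇒inject₁ {suc n} {zero}  {suc j} _   = zero , refl
<⇒inject₁ {suc n} {suc i} {suc j} i<j with <⇒inject₁ (s≤s⁻¹ i<j)
... | i′ , refl = suc i′ , refl

-- Sums and submodules of a module.

module _ {r ℓr m ℓm} {A : CommutativeRing r ℓr} (M : Module A m ℓm) where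
  open Module M
  open CommutativeMonoidSum +ᴹ-commutativeMonoid using (sum; sum-replicate-zero)
  private module A = CommutativeRing A

  sum-additive : ∀ (f : ∣ M ∣ → ∣ M ∣) → f 0ᴹ ≈ᴹ 0ᴹ →
    (∀ x y → f (x +ᴹ y) ≈ᴹ f x +ᴹ f y) →
    ∀ {k} (y : Fin k → ∣ M ∣) → f (sum y) ≈ᴹ sum (f ∘ y)
  sum-additive f f-0 f-+ {ℕ.zero} y = f-0
  sum-additive f f-0 f-+ {suc k}  y = ≈ᴹ-trans (f-+ _ _)
    (+ᴹ-cong ≈ᴹ-refl (sum-additive f f-0 f-+ (y ∘ suc)))

  -1*ₗ : ∀ x → (A.- A.1#) *ₗ x ≈ᴹ -ᴹ x
  -1*ₗ x = ModuleProperties.inverseʳ-uniqueᴹ M x _ (begin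
    x +ᴹ (A.- A.1#) *ₗ x            ≈⟨ +ᴹ-cong (*ₗ-identityˡ x) ≈ᴹ-refl ⟨
    A.1# *ₗ x +ᴹ (A.- A.1#) *ₗ x    ≈⟨ *ₗ-distribʳ x _ _ ⟨
    (A.1# A.+ (A.- A.1#)) *ₗ x      ≈⟨ *ₗ-cong (A.-‿inverseʳ A.1#) ≈ᴹ-refl ⟩
    A.0# *ₗ x                       ≈⟨ *ₗ-zeroˡ x ⟩
    0ᴹ                              ∎)
    where open SetoidReasoning ≈ᴹ-setoid

  -‿closed : ∀ {ℓ} (P : Submodule M ℓ) {x} → x ∈ ⟨ P ⟩ → (-ᴹ x) ∈ ⟨ P ⟩
  -‿closed P x∈P = Submodule.resp P (-1*ₗ _) (Submodule.*ₗ-closed P _ x∈P)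

  ∑-inclusion : ∀ {ℓ} k (P : Fin k → Submodule M ℓ) i {x} →
                x ∈ ⟨ P i ⟩ → x ∈ ⟨ ∑ {M = M} k P ⟩
  ∑-inclusion (suc k) P zero {x} x∈P =
      (λ { zero → x ; (suc i) → 0ᴹ })
    , (λ { zero → x∈P ; (suc i) → Submodule.0-closed (P (suc i)) })
    , ≈ᴹ-sym (≈ᴹ-trans (+ᴹ-cong ≈ᴹ-refl (sum-replicate-zero k)) (+ᴹ-identityʳ x))
  ∑-inclusion (suc k) P (suc i) {x} x∈P with ∑-inclusion k (P ∘ suc) i x∈P
  ... | y , y∈P , x≈∑y =
      (λ { zero → 0ᴹ ; (suc i) → y i })
    , (λ { zero → Submodule.0-closed (P zero) ; (suc i) → y∈P i })
    , ≈ᴹ-trans x≈∑y (≈ᴹ-sym (+ᴹ-identityˡ _))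

-- A single filler step.

module _ {r ℓr m ℓm} {A : CommutativeRing r ℓr} (X : SimplicialModule A m ℓm) where
  open SimplicialModule X

  private
    module Ob n = Module (Ob n)
    module d {n} (i : Fin (2 + n)) =
      ModuleMorphisms.IsModuleHomomorphism (d-linear i)
    module s {n} (i : Fin (1 + n)) =
      ModuleMorphisms.IsModuleHomomorphism (s-linear i)

  d-cancel : ∀ {n} (k : Fin (2 + n)) {x y} → Ob._≈ᴹ_ n (d k x) (d k y) →
    Ob._≈ᴹ_ n (d k (Ob._+ᴹ_ (suc n) x (Ob.-ᴹ_ (suc n) y))) (Ob.0ᴹ n)
  d-cancel {n} k {x} {y} dx≈dy = begin
    d k (x Xₚ.+ᴹ (Xₚ.-ᴹ y))       ≈⟨ d.+ᴹ-homo k _ _ ⟩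
    d k x +ᴹ d k (Xₚ.-ᴹ y)        ≈⟨ +ᴹ-cong dx≈dy (d.-ᴹ-homo k _) ⟩
    d k y +ᴹ (-ᴹ d k y)           ≈⟨ -ᴹ‿inverseʳ _ ⟩
    0ᴹ                            ∎
    where
    open Module (Ob n)
    module Xₚ = Module (Ob (suc n))
    open SetoidReasoning ≈ᴹ-setoid

  module _ {n : ℕ} where
    private
      module Xₙ = Module (Ob n)
      module Xₚ = Module (Ob (suc n))
    open CommutativeMonoidSum Xₚ.+ᴹ-commutativeMonoid using (sum)

    Im-s : Fin (1 + n) → Submodule (Ob (suc n)) _
    Im-s r = im (Ob n) (Ob (suc n)) (s-linear r)

    -- Common form of the `yes` branches of `stepI` (`c = inject₁ i`) and `stepII` (`c = suc i`),
    -- which reduce to it definitionally.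
    fill : Fin (1 + n) → Fin (2 + n) → ∣ Ob n ∣ → ∣ Ob (suc n) ∣ → ∣ Ob (suc n) ∣
    fill i c x T = T Xₚ.+ᴹ s i (x Xₙ.+ᴹ (Xₙ.-ᴹ d c T))

    fill-face : ∀ i c x T → (∀ w → d c (s i w) Xₙ.≈ᴹ w) → d c (fill i c x T) Xₙ.≈ᴹ x
    fill-face i c x T dcsi≈id = begin
      d c (fill i c x T)                             ≈⟨ d.+ᴹ-homo c _ _ ⟩
      d c T Xₙ.+ᴹ d c (s i (x Xₙ.+ᴹ (Xₙ.-ᴹ d c T)))  ≈⟨ Xₙ.+ᴹ-cong Xₙ.≈ᴹ-refl (dcsi≈id _) ⟩
      d c T Xₙ.+ᴹ (x Xₙ.+ᴹ (Xₙ.-ᴹ d c T))            ≈⟨ Xₙ.+ᴹ-assoc _ _ _ ⟨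
      d c T Xₙ.+ᴹ x Xₙ.+ᴹ (Xₙ.-ᴹ d c T)              ≈⟨ xyx⁻¹≈y _ _ ⟩
      x                                              ∎
      where
      open SetoidReasoning Xₙ.≈ᴹ-setoid
      open AbelianGroupProperties Xₙ.+ᴹ-abelianGroup using (xyx⁻¹≈y)

    fill-preserves : ∀ i c k x T {z} → d k T Xₙ.≈ᴹ z →
      d k (s i (x Xₙ.+ᴹ (Xₙ.-ᴹ d c T))) Xₙ.≈ᴹ Xₙ.0ᴹ → d k (fill i c x T) Xₙ.≈ᴹ z
    fill-preserves i c k x T dT≈z ds≈0 = Xₙ.≈ᴹ-trans (d.+ᴹ-homo k _ _)
      (Xₙ.≈ᴹ-trans (Xₙ.+ᴹ-cong dT≈z ds≈0) (Xₙ.+ᴹ-identityʳ _))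

    fill∈D : ∀ i c x {T} → T ∈ ⟨ D X n ⟩ → fill i c x T ∈ ⟨ D X n ⟩
    fill∈D i c x T∈D = Submodule.+-closed (D X n) T∈D
      (∑-inclusion (Ob (suc n)) (suc n) Im-s i (_ , Xₚ.≈ᴹ-refl))

    -- Eliminating terms from sums of degenerate elements.

    -- `S` holds the indices of terms already eliminated: the empty `S` is membership in `D`, the
    -- full `S` forces `x` to be 0.
    Dropping : Pred (Fin (1 + n)) 0ℓ → Pred ∣ Ob (suc n) ∣ _
    Dropping S x = ∃ λ y → (∀ r → y r ∈ ⟨ Im-s r ⟩)
      × (∀ r → S r → y r Xₚ.≈ᴹ Xₚ.0ᴹ) × x Xₚ.≈ᴹ sum y

    Dropping-weaken : ∀ {S S′} → (∀ r → S′ r → S r) → ∀ {x} →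
                      x ∈ Dropping S → x ∈ Dropping S′
    Dropping-weaken S′⊆S (y , y∈im , y≈0 , x≈∑y) =
      y , y∈im , (λ r r∈S′ → y≈0 r (S′⊆S r r∈S′)) , x≈∑y

    module _ (i : Fin (1 + n)) (c : Fin (2 + n)) where
      open CommutativeSemigroupProperties
        (CommutativeMonoid.commutativeSemigroup Xₚ.+ᴹ-commutativeMonoid)
        using (interchange)

      -- Up to linearity this is `fill i c` with target 0. When d_c sᵢ = id it is the projection
      -- onto ker d_c along im sᵢ.
      retract : ∣ Ob (suc n) ∣ → ∣ Ob (suc n) ∣
      retract T = T Xₚ.+ᴹ (Xₚ.-ᴹ s i (d c T))

      private
        sd-cong : ∀ {x y} → x Xₚ.≈ᴹ y → s i (d c x) Xₚ.≈ᴹ s i (d c y)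
        sd-cong x≈y = s.⟦⟧-cong i (d.⟦⟧-cong c x≈y)

      retract-cong : ∀ {x y} → x Xₚ.≈ᴹ y → retract x Xₚ.≈ᴹ retract y
      retract-cong x≈y = Xₚ.+ᴹ-cong x≈y (Xₚ.-ᴹ‿cong (sd-cong x≈y))

      retract-fixes : ∀ {x} → d c x Xₙ.≈ᴹ Xₙ.0ᴹ → retract x Xₚ.≈ᴹ x
      retract-fixes {x} dx≈0 = begin
        x Xₚ.+ᴹ (Xₚ.-ᴹ s i (d c x)) ≈⟨ +-congˡ (Xₚ.-ᴹ‿cong (s.⟦⟧-cong i dx≈0)) ⟩
        x Xₚ.+ᴹ (Xₚ.-ᴹ s i Xₙ.0ᴹ)   ≈⟨ +-congˡ (Xₚ.-ᴹ‿cong (s.0ᴹ-homo i)) ⟩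
        x Xₚ.+ᴹ (Xₚ.-ᴹ Xₚ.0ᴹ)       ≈⟨ +-congˡ (GroupProperties.ε⁻¹≈ε Xₚ.+ᴹ-group) ⟩
        x Xₚ.+ᴹ Xₚ.0ᴹ               ≈⟨ Xₚ.+ᴹ-identityʳ x ⟩
        x                           ∎
        where
        open SetoidReasoning Xₚ.≈ᴹ-setoid
        open Module (Ob (suc n)) using () renaming (+ᴹ-congˡ to +-congˡ)

      retract-0 : retract Xₚ.0ᴹ Xₚ.≈ᴹ Xₚ.0ᴹ
      retract-0 = retract-fixes (d.0ᴹ-homo c)

      retract-+ : ∀ x y → retract (x Xₚ.+ᴹ y) Xₚ.≈ᴹ retract x Xₚ.+ᴹ retract y
      retract-+ x y = begin
        x Xₚ.+ᴹ y Xₚ.+ᴹ (Xₚ.-ᴹ s i (d c (x Xₚ.+ᴹ y)))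
          ≈⟨ Xₚ.+ᴹ-cong Xₚ.≈ᴹ-refl (Xₚ.-ᴹ‿cong
               (Xₚ.≈ᴹ-trans (s.⟦⟧-cong i (d.+ᴹ-homo c x y)) (s.+ᴹ-homo i _ _))) ⟩
        x Xₚ.+ᴹ y Xₚ.+ᴹ (Xₚ.-ᴹ (s i (d c x) Xₚ.+ᴹ s i (d c y)))
          ≈⟨ Xₚ.+ᴹ-cong Xₚ.≈ᴹ-refl
               (AbelianGroupProperties.⁻¹-∙-comm Xₚ.+ᴹ-abelianGroup _ _) ⟨
        x Xₚ.+ᴹ y Xₚ.+ᴹ ((Xₚ.-ᴹ s i (d c x)) Xₚ.+ᴹ (Xₚ.-ᴹ s i (d c y)))
          ≈⟨ interchange _ _ _ _ ⟩
        retract x Xₚ.+ᴹ retract y ∎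
        where open SetoidReasoning Xₚ.≈ᴹ-setoid

      retract-kills : (∀ w → d c (s i w) Xₙ.≈ᴹ w) → ∀ {y} →
        y ∈ ⟨ Im-s i ⟩ → retract y Xₚ.≈ᴹ Xₚ.0ᴹ
      retract-kills dcsi≈id (w , sw≈y) = GroupProperties.x≈y⇒x∙y⁻¹≈ε Xₚ.+ᴹ-group
        (Xₚ.≈ᴹ-sym (Xₚ.≈ᴹ-trans (sd-cong (Xₚ.≈ᴹ-sym sw≈y))
          (Xₚ.≈ᴹ-trans (s.⟦⟧-cong i (dcsi≈id w)) sw≈y)))

      Stable : Fin (1 + n) → Set _
      Stable r = ∀ w → s i (d c (s r w)) ∈ ⟨ Im-s r ⟩

      retract-im : ∀ r → Stable r → ∀ {y} → y ∈ ⟨ Im-s r ⟩ →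
        retract y ∈ ⟨ Im-s r ⟩
      retract-im r stable {y} y∈im@(w , sw≈y) = I.+-closed y∈im
        (-‿closed (Ob (suc n)) (Im-s r) (I.resp (sd-cong sw≈y) (stable w)))
        where module I = Submodule (Im-s r)

      -- Applying `retract` to every term leaves the sum `x` unchanged, as d_c x = 0. Zero terms
      -- stay zero, term `i` is killed, and a stable term stays in its own image.
      drop-term : ∀ {S S′ : Pred (Fin (1 + n)) 0ℓ} → (∀ w → d c (s i w) Xₙ.≈ᴹ w) →
        (∀ r → S r ⊎ r ≡ i ⊎ Stable r) → (∀ r → S′ r → S r ⊎ r ≡ i) →
        ∀ {x} → d c x Xₙ.≈ᴹ Xₙ.0ᴹ → x ∈ Dropping S → x ∈ Dropping S′
      drop-term {S} {S′} dcsi≈id cases S′⊆S∪i {x} dx≈0 (y , y∈im , y≈0 , x≈∑y) =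
        retract ∘ y , retract∈im , retract≈0 , (begin
          x                  ≈⟨ retract-fixes dx≈0 ⟨
          retract x          ≈⟨ retract-cong x≈∑y ⟩
          retract (sum y)    ≈⟨ sum-additive (Ob (suc n)) retract retract-0 retract-+ y ⟩
          sum (retract ∘ y)  ∎)
        where
        open SetoidReasoning Xₚ.≈ᴹ-setoid

        vanish : ∀ r → S r ⊎ r ≡ i → retract (y r) Xₚ.≈ᴹ Xₚ.0ᴹ
        vanish r (inj₁ r∈S)  = Xₚ.≈ᴹ-trans (retract-cong (y≈0 r r∈S)) retract-0
        vanish r (inj₂ refl) = retract-kills dcsi≈id (y∈im r)

        0∈im : ∀ {r z} → z Xₚ.≈ᴹ Xₚ.0ᴹ → z ∈ ⟨ Im-s r ⟩
        0∈im {r} z≈0 = Submodule.resp (Im-s r) (Xₚ.≈ᴹ-sym z≈0)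
          (Submodule.0-closed (Im-s r))

        retract∈im : ∀ r → retract (y r) ∈ ⟨ Im-s r ⟩
        retract∈im r with cases r
        ... | inj₁ r∈S           = 0∈im (vanish r (inj₁ r∈S))
        ... | inj₂ (inj₁ r≡i)    = 0∈im (vanish r (inj₂ r≡i))
        ... | inj₂ (inj₂ stable) = retract-im r stable (y∈im r)

        retract≈0 : ∀ r → S′ r → retract (y r) Xₚ.≈ᴹ Xₚ.0ᴹ
        retract≈0 r r∈S′ = vanish r (S′⊆S∪i r r∈S′)

  -- For i < r: sᵢ dᵢ s_r = sᵢ s_{r-1} dᵢ = s_r sᵢ dᵢ.
  stable-low : ∀ {n} {i r : Fin (1 + n)} → i < r → Stable i (inject₁ i) r
  stable-low {suc n} {i} {suc r} i<r w with <⇒inject₁ i<r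
  ... | i′ , refl = s i′ (d (inject₁ i′) w) , (begin
    s (suc r) (s i′ (d (inject₁ i′) w))             ≈⟨ s-s i′≤r _ ⟨
    s (inject₁ i′) (s r (d (inject₁ i′) w))         ≈⟨ s.⟦⟧-cong (inject₁ i′) (d-s-< i≤r w) ⟨
    s (inject₁ i′) (d (inject₁ (inject₁ i′)) (s (suc r) w)) ∎)
    where
    open SetoidReasoning (Module.≈ᴹ-setoid (Ob (2 + n)))
    i≤r = s≤s⁻¹ i<r
    i′≤r = subst (ℕ._≤ toℕ r) (toℕ-inject₁ i′) i≤r

  -- For r < i: sᵢ dᵢ₊₁ s_r = sᵢ s_r dᵢ = s_r sᵢ₋₁ dᵢ.
  stable-high : ∀ {n} {i r : Fin (1 + n)} → r < i → Stable i (suc i) r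
  stable-high {suc n} {suc i} {r} r<i w with <⇒inject₁ r<i
  ... | r′ , refl = s i (d (suc i) w) , (begin
    s (inject₁ r′) (s i (d (suc i) w))       ≈⟨ s-s (s≤s⁻¹ r′<i) _ ⟩
    s (suc i) (s r′ (d (suc i) w))           ≈⟨ s.⟦⟧-cong (suc i) (d-s-> r′<i w) ⟨
    s (suc i) (d (suc (suc i)) (s (inject₁ r′) w)) ∎)
    where
    open SetoidReasoning (Module.≈ᴹ-setoid (Ob (2 + n)))
    r′<i = subst (ℕ._< suc (toℕ i)) (toℕ-inject₁ r′) r<i

  -- The horn condition and preservation of faces.

  -- `Φ` splits on `n` to supply the horn proof, so its faces reduce only after the same split.
  Φ-face : ∀ n j T k → proj₁ (Φ X n j T) k ≡ d (proj₁ k) T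
  Φ-face ℕ.zero  j T k = refl
  Φ-face (suc n) j T k = refl

  -- d_k moves past sᵢ as k < i, and the horn condition gives d_k x_c = d_{c-1} x_k = d_{c-1} d_k T
  -- = d_k d_c T. Leaving `c` free serves both phases.
  horn-low : ∀ {n j x} → x ∈ ⟨ Horns X n j ⟩ →
    ∀ {i : Fin (1 + n)} {k c : Fin (2 + n)} (k≢j : k ≢ j) (c≢j : c ≢ j) →
    toℕ k ℕ.< toℕ i → k < c → ∀ {T} → Ob._≈ᴹ_ n (d k T) (x (k , k≢j)) →
    Ob._≈ᴹ_ n (d k (s i (Ob._+ᴹ_ n (x (c , c≢j)) (Ob.-ᴹ_ n (d c T))))) (Ob.0ᴹ n)
  horn-low {ℕ.zero} x∈H {zero} _ _ ()
  horn-low {suc n} {x = x} x∈H {suc i} {k} {suc l} k≢j c≢j k<i k<c {T} dT≈x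
    with <⇒inject₁ k<c
  ... | k′ , refl = begin
    d (inject₁ k′) (s (suc i) y)   ≈⟨ d-s-< k′≤i y ⟩
    s i (d k′ y)                   ≈⟨ s.⟦⟧-cong i (d-cancel k′ dx≈ddT) ⟩
    s i 0ᴹ                         ≈⟨ s.0ᴹ-homo i ⟩
    Ob.0ᴹ (suc n)                  ∎
    where
    open Module (Ob n) using (0ᴹ; ≈ᴹ-trans; ≈ᴹ-sym)
    open SetoidReasoning (Module.≈ᴹ-setoid (Ob (suc n)))
    y = Ob._+ᴹ_ (suc n) (x (suc l , c≢j)) (Ob.-ᴹ_ (suc n) (d (suc l) T))
    k′≤i = subst (ℕ._≤ toℕ i) (toℕ-inject₁ k′) (s≤s⁻¹ k<i)
    k′≤l = subst (ℕ._≤ toℕ l) (toℕ-inject₁ k′) (s≤s⁻¹ k<c)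
    dx≈ddT = ≈ᴹ-trans (x∈H k′≤l k≢j c≢j)
      (≈ᴹ-trans (d.⟦⟧-cong l (Ob.≈ᴹ-sym (suc n) dT≈x)) (≈ᴹ-sym (d-d k′≤l T)))

  -- Mirror image for phase II, where higher faces are already correct: d_k sᵢ = sᵢ d_{k-1}, and
  -- with c = i + 1, d_{k-1} x_c = d_c x_k = d_c d_k T = d_{k-1} d_c T.
  horn-high : ∀ {n j x} → x ∈ ⟨ Horns X n j ⟩ →
    ∀ {i : Fin (1 + n)} {k : Fin (2 + n)} (k≢j : k ≢ j) (c≢j : suc i ≢ j) →
    suc i < k → ∀ {T} → Ob._≈ᴹ_ n (d k T) (x (k , k≢j)) →
    Ob._≈ᴹ_ n (d k (s i (Ob._+ᴹ_ n (x (suc i , c≢j)) (Ob.-ᴹ_ n (d (suc i) T))))) (Ob.0ᴹ n)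
  horn-high {ℕ.zero} x∈H {zero} {suc zero} _ _ (s≤s ())
  horn-high {suc n} {x = x} x∈H {i} {suc k} k≢j c≢j c<k {T} dT≈x
    with <⇒inject₁ (s≤s⁻¹ c<k)
  ... | i′ , refl = begin
    d (suc k) (s (inject₁ i′) y)   ≈⟨ d-s-> i′<k y ⟩
    s i′ (d k y)                   ≈⟨ s.⟦⟧-cong i′ (d-cancel k dx≈ddT) ⟩
    s i′ 0ᴹ                        ≈⟨ s.0ᴹ-homo i′ ⟩
    Ob.0ᴹ (suc n)                  ∎
    where
    open Module (Ob n) using (0ᴹ; ≈ᴹ-trans; ≈ᴹ-sym)
    open SetoidReasoning (Module.≈ᴹ-setoid (Ob (suc n)))
    y = Ob._+ᴹ_ (suc n) (x (suc (inject₁ i′) , c≢j))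
          (Ob.-ᴹ_ (suc n) (d (suc (inject₁ i′)) T))
    i′<k = subst (ℕ._< toℕ k) (toℕ-inject₁ i′) (s≤s⁻¹ c<k)
    dx≈ddT = ≈ᴹ-trans (≈ᴹ-sym (x∈H i′<k c≢j k≢j))
      (≈ᴹ-trans (d.⟦⟧-cong (suc i′) (Ob.≈ᴹ-sym (suc n) dT≈x)) (d-d i′<k T))

  -- Faces of the Moore filler.

  module _ (n : ℕ) (j : Fin (2 + n)) where
    private
      module Xₙ = Module (Ob n)
      module Xₚ = Module (Ob (suc n))
      module D = Submodule (D X n)

    μ∈D : ∀ H → μ X n j H ∈ ⟨ D X n ⟩
    μ∈D (x , _) = foldr-invariant (λ _ → ⟨ D X n ⟩) (stepII X n j x) id stepII∈D
      (foldl-invariant (λ _ → ⟨ D X n ⟩) (stepI X n j x) id stepI∈D D.0-closed)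
      where
      stepI∈D : ∀ i {T} → T ∈ ⟨ D X n ⟩ → stepI X n j x T i ∈ ⟨ D X n ⟩
      stepI∈D i T∈D with inject₁ i <? j
      ... | yes _ = fill∈D i (inject₁ i) _ T∈D
      ... | no  _ = T∈D

      stepII∈D : ∀ i {U} → U ∈ ⟨ D X n ⟩ → stepII X n j x i U ∈ ⟨ D X n ⟩
      stepII∈D i U∈D with j <? suc i
      ... | yes _ = fill∈D i (suc i) _ U∈D
      ... | no  _ = U∈D

    Agrees : ∣ FaceTuples X n j ∣ → Pred (Fin (2 + n)) 0ℓ → Pred ∣ Ob (suc n) ∣ _
    Agrees x S T = ∀ {k} (k≢j : k ≢ j) → S k → d k T Xₙ.≈ᴹ x (k , k≢j)

    phaseI-agrees : ∀ {x} → x ∈ ⟨ Horns X n j ⟩ → phaseI X n j x ∈ Agrees x (_< j)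
    phaseI-agrees {x} x∈H k≢j k<j =
      -- After `m` entries the faces below both `m` and `j` are correct. At the end m = p ≥ j, so
      -- the first bound follows from k < j.
      foldl-invariant (λ m → Agrees x (λ k → toℕ k ℕ.< m × k < j)) (stepI X n j x) id
        step (λ { _ (() , _) }) k≢j (ℕ.<-≤-trans k<j (s≤s⁻¹ (toℕ<n j)) , k<j)
      where
      step : ∀ i {T} → T ∈ Agrees x (λ k → toℕ k ℕ.< toℕ i × k < j) →
             stepI X n j x T i ∈ Agrees x (λ k → toℕ k ℕ.< suc (toℕ i) × k < j)
      step i {T} agrees {k} k≢j (k<1+i , k<j) with inject₁ i <? j
      ... | yes i<j = by-cases (ℕ.m<1+n⇒m<n∨m≡n k<1+i)
        where
        by-cases : toℕ k ℕ.< toℕ i ⊎ toℕ k ≡ toℕ i →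
          d k (fill i (inject₁ i) (x (inject₁ i , <⇒≢ i<j)) T) Xₙ.≈ᴹ x (k , k≢j)
        by-cases (inj₁ k<i) = fill-preserves i (inject₁ i) k _ T agree
          (horn-low x∈H k≢j (<⇒≢ i<j) k<i
            (subst (toℕ k ℕ.<_) (sym (toℕ-inject₁ i)) k<i) agree)
          where agree = agrees k≢j (k<i , k<j)
        by-cases (inj₂ k≡i)
          with toℕ-injective {j = inject₁ i} (trans k≡i (sym (toℕ-inject₁ i)))
        ... | refl = fill-face i (inject₁ i) _ T (d-s-≡ i)
      -- The step is skipped with j ≤ i, so k < j already gives k < i.
      ... | no  i≮j = agrees k≢j (ℕ.<-≤-trans k<j j≤i , k<j)
        where j≤i = subst (toℕ j ℕ.≤_) (toℕ-inject₁ i) (ℕ.≮⇒≥ i≮j)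

    phaseII-agrees : ∀ {x T} → x ∈ ⟨ Horns X n j ⟩ → T ∈ Agrees x (_< j) →
      ∀ {k} (k≢j : k ≢ j) → d k (phaseII X n j x T) Xₙ.≈ᴹ x (k , k≢j)
    phaseII-agrees {x} {T} x∈H T-agrees {k} k≢j =
      foldr-invariant (λ m → Agrees x (Outside m)) (stepII X n j x) id
        step start k≢j side
      where
      Outside : ℕ → Pred (Fin (2 + n)) 0ℓ
      -- The inequality is strict because entry `i` of the fold corrects face i + 1: entries from
      -- `m` on correct faces above `m`.
      Outside m k = k < j ⊎ m ℕ.< toℕ k

      side : Outside 0 k
      side with <-cmp k j
      ... | tri< k<j _ _ = inj₁ k<j
      ... | tri≈ _ k≡j _ = contradiction k≡j k≢j
      ... | tri> _ _ j<k = inj₂ (ℕ.≤-<-trans z≤n j<k)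

      start : T ∈ Agrees x (Outside (suc n))
      start k≢j (inj₁ k<j) = T-agrees k≢j k<j
      start {k} k≢j (inj₂ n<k) = contradiction n<k (ℕ.≤⇒≯ (s≤s⁻¹ (toℕ<n k)))

      -- A skipped step has i + 1 ≤ j, so a face k > i other than `j` is either below `j` or above i
      -- + 1.
      step : ∀ i {U} → U ∈ Agrees x (Outside (suc (toℕ i))) →
             stepII X n j x i U ∈ Agrees x (Outside (toℕ i))
      step i {U} agrees {k} k≢j outside with j <? suc i
      ... | no  j≮1+i = agrees k≢j (shift outside)
        where
        shift : Outside (toℕ i) k → Outside (suc (toℕ i)) k
        shift (inj₁ k<j) = inj₁ k<j
        shift (inj₂ _) with <-cmp k j
        ... | tri< k<j _ _ = inj₁ k<j
        ... | tri≈ _ k≡j _ = contradiction k≡j k≢j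
        ... | tri> _ _ j<k = inj₂ (ℕ.≤-<-trans (ℕ.≮⇒≥ j≮1+i) j<k)
      ... | yes j<1+i with <-cmp k (suc i) | outside
      ...   | tri< k<1+i _ _ | inj₂ i<k = contradiction i<k (ℕ.<⇒≱ k<1+i)
      -- From k < j ≤ i comes the strict k < i that lets d_k move past sᵢ; phase I faces thus
      -- survive phase II.
      ...   | tri< k<1+i _ _ | inj₁ k<j = fill-preserves i (suc i) k _ U agree
              (horn-low x∈H k≢j _ (ℕ.<-≤-trans k<j (s≤s⁻¹ j<1+i)) k<1+i agree)
              where agree = agrees k≢j (inj₁ k<j)
      ...   | tri≈ _ refl _  | _        = fill-face i (suc i) _ U (d-s-suc i)
      ...   | tri> _ _ 1+i<k | _        = fill-preserves i (suc i) k _ U agree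
              (horn-high x∈H k≢j _ 1+i<k agree)
              where agree = agrees k≢j (inj₂ 1+i<k)

    μ-face : ∀ H {k} (k≢j : k ≢ j) → d k (μ X n j H) Xₙ.≈ᴹ proj₁ H (k , k≢j)
    μ-face (x , x∈H) = phaseII-agrees x∈H (phaseI-agrees x∈H)

    -- The direct sum decomposition.

    -- By `μ-face`, `μ (Φ x)` and `x` have the same faces off `j`. This is the `R` component of `x`.
    -μΦ∈R : ∀ x → (x Xₚ.+ᴹ (Xₚ.-ᴹ μ X n j (Φ X n j x))) ∈ ⟨ R X n j ⟩
    -μΦ∈R x (k , k≢j) = d-cancel k (Xₙ.≈ᴹ-sym (Xₙ.≈ᴹ-trans (μ-face (Φ X n j x) k≢j)
      (Xₙ.≈ᴹ-reflexive (Φ-face n j x (k , k≢j)))))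

    R∩D≈0 : ∀ {x} → x ∈ ⟨ R X n j ⟩ → x ∈ ⟨ D X n ⟩ → x Xₚ.≈ᴹ Xₚ.0ᴹ
    R∩D≈0 {x} x∈R (y , y∈im , x≈∑y)
      -- The inner induction ascends from an empty set of eliminated indices to r < j; the outer one
      -- descends to m = 0 and eliminates r ≥ j.
      with >-weakInduction Q (Dropping-weaken S′⊆S
             (<-weakInduction P (y , y∈im , (λ { _ (() , _) }) , x≈∑y) stepP _))
             stepQ zero
      where
      S : Fin (2 + n) → Pred (Fin (1 + n)) 0ℓ
      S m r = toℕ r ℕ.< toℕ m × toℕ r ℕ.< toℕ j

      S′ : Fin (2 + n) → Pred (Fin (1 + n)) 0ℓ
      S′ m r = toℕ r ℕ.< toℕ j ⊎ toℕ m ℕ.≤ toℕ r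

      -- Handover at m = p: every r is below p, so both predicates amount to r < j.
      S′⊆S : ∀ r → S′ (fromℕ (suc n)) r → S (fromℕ (suc n)) r
      S′⊆S r r∈S′ rewrite toℕ-fromℕ n with r∈S′
      ... | inj₁ r<j = toℕ<n r , r<j
      ... | inj₂ n<r = contradiction n<r (ℕ.<⇒≱ (toℕ<n r))

      P Q : Pred (Fin (2 + n)) _
      P m = x ∈ Dropping (S m)
      Q m = x ∈ Dropping (S′ m)

      stepP : ∀ i → P (inject₁ i) → P (suc i)
      stepP i with inject₁ i <? j
      ... | yes i<j = drop-term i (inject₁ i) (d-s-≡ i) cases shift
                      (x∈R (inject₁ i , <⇒≢ i<j))
        where
        i<j′ = subst (ℕ._< toℕ j) (toℕ-inject₁ i) i<j

        -- Ascending order matters at r = i - 1: there dᵢ s_r = id, so sᵢ dᵢ would move that term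
        -- into im sᵢ, but it is already zero.
        cases : ∀ r → S (inject₁ i) r ⊎ r ≡ i ⊎ Stable i (inject₁ i) r
        cases r with <-cmp r i
        ... | tri< r<i _ _ = inj₁ ( subst (toℕ r ℕ.<_) (sym (toℕ-inject₁ i)) r<i
                                  , ℕ.<-trans r<i i<j′)
        ... | tri≈ _ r≡i _ = inj₂ (inj₁ r≡i)
        ... | tri> _ _ i<r = inj₂ (inj₂ (stable-low i<r))

        shift : ∀ r → S (suc i) r → S (inject₁ i) r ⊎ r ≡ i
        shift r (r<1+i , r<j) = Sum.map
          (λ r<i → subst (toℕ r ℕ.<_) (sym (toℕ-inject₁ i)) r<i , r<j) toℕ-injective
          (ℕ.m<1+n⇒m<n∨m≡n r<1+i)
      ... | no i≮j = Dropping-weaken λ { r (_ , r<j) → ℕ.<-≤-trans r<j (ℕ.≮⇒≥ i≮j) , r<j }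

      stepQ : ∀ i → Q (suc i) → Q (inject₁ i)
      stepQ i with j <? suc i
      ... | yes j<1+i = drop-term i (suc i) (d-s-suc i) cases shift
                          (x∈R (suc i , ≢-sym (<⇒≢ j<1+i)))
        where
        -- Descending order matters at r = i + 1, where dᵢ₊₁ s_r = id; that term is already zero.
        cases : ∀ r → S′ (suc i) r ⊎ r ≡ i ⊎ Stable i (suc i) r
        cases r with <-cmp r i
        ... | tri< r<i _ _ = inj₂ (inj₂ (stable-high r<i))
        ... | tri≈ _ r≡i _ = inj₂ (inj₁ r≡i)
        ... | tri> _ _ i<r = inj₁ (inj₂ i<r)

        shift : ∀ r → S′ (inject₁ i) r → S′ (suc i) r ⊎ r ≡ i
        shift r (inj₁ r<j) = inj₁ (inj₁ r<j)
        shift r (inj₂ i≤r) = Sum.map inj₂ (sym ∘ toℕ-injective)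
          (ℕ.m≤n⇒m<n∨m≡n (subst (ℕ._≤ toℕ r) (toℕ-inject₁ i) i≤r))
      -- Here i + 1 ≤ j, so `S′ (suc i)` already contains every index.
      ... | no j≮1+i = Dropping-weaken λ r _ →
        Sum.map₂ (ℕ.≤-trans (ℕ.≮⇒≥ j≮1+i)) (ℕ.<-≤-connex (toℕ r) (toℕ j))
    -- At m = 0 every `r` satisfies `S′`, so all terms vanish.
    ... | y′ , _ , y′≈0 , x≈∑y′ = Xₚ.≈ᴹ-trans x≈∑y′ (Xₚ.≈ᴹ-trans
      (sum-cong-≋ (λ r → y′≈0 r (inj₂ z≤n))) (sum-replicate-zero (suc n)))
      where
      open CommutativeMonoidSum Xₚ.+ᴹ-commutativeMonoid
        using (sum-cong-≋; sum-replicate-zero)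

theorem6p2 : ∀ {r ℓr m ℓm} (A : CommutativeRing r ℓr) (X : SimplicialModule A m ℓm) (n : ℕ) (j : Fin (2 + n)) →
    (∀ H → _≈ᴴ_ X n j (Φ X n j (μ X n j H)) H)
    × IsDirectSum (SimplicialModule.Ob X (suc n)) (R X n j) (D X n)
    × (Im-μ X n j ≐ ⟨ D X n ⟩)
theorem6p2 A X n j = section , direct , im⊆D , D⊆im
  where
  open SimplicialModule X
  module Xₙ = Module (Ob n)
  module Xₚ = Module (Ob (suc n))
  module D = Submodule (D X n)

  section : ∀ H → _≈ᴴ_ X n j (Φ X n j (μ X n j H)) H
  section H (k , k≢j) = Xₙ.≈ᴹ-trans
    (Xₙ.≈ᴹ-reflexive (Φ-face X n j (μ X n j H) (k , k≢j))) (μ-face X n j H k≢j)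

  direct : IsDirectSum (Ob (suc n)) (R X n j) (D X n)
  direct = record
    { spanning = λ x → _ , _ , -μΦ∈R X n j x , μ∈D X n j (Φ X n j x)
                     , Xₚ.≈ᴹ-sym (GroupProperties.//-rightDividesˡ Xₚ.+ᴹ-group _ x)
    ; disjoint = R∩D≈0 X n j
    }

  im⊆D : ∀ {y} → Im-μ X n j y → y ∈ ⟨ D X n ⟩
  im⊆D (H , μH≈y) = D.resp μH≈y (μ∈D X n j H)

  D⊆im : ∀ {y} → y ∈ ⟨ D X n ⟩ → Im-μ X n j y
  -- The horn of `y` itself is the witness: `y - μ (Φ y)` lies in `R`, and in `D` since both terms
  -- do, hence is 0.
  D⊆im {y} y∈D = Φ X n j y , Xₚ.≈ᴹ-sym (GroupProperties.x∙y⁻¹≈ε⇒x≈y Xₚ.+ᴹ-group y _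
    (R∩D≈0 X n j (-μΦ∈R X n j y)
      (D.+-closed y∈D (-‿closed (Ob (suc n)) (D X n) (μ∈D X n j (Φ X n j y))))))
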